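{- Let $G$ be a connected graph of order $n \ge 3$ with minimum degree $\delta \ge 2$. Then \[ \gamma_{\rm it}^{\rm g\prime}(G) \le \left( \frac{2\delta-1}{3\delta-2} \right) n - \frac{(\delta - 1)(2\delta - 3)}{3\delta-2}, \] where $\gamma_{\rm it}^{\rm g\prime}(G)$ is the Staller-start game total isolation number of $G$.
   Context: All graphs are finite and simple. For a vertex set $S$, $N_G(S)$ denotes the set of vertices adjacent to at least one vertex of $S$, and $G - X$ is the graph obtained by deleting the vertices of $X$. The total isolation game on a graph $G$ is played by two players, Dominator and Staller, who alternately select vertices of $G$. If $S$ is the set of vertices selected so far, a vertex $v$ may be selected only if $v$ is adjacent to some vertex $u$ such that either $u$ belongs to a component of $G - N_G(S)$ of order at least $2$, or $u \in S$ and $u$ is an isolated vertex of $G - N_G(S)$. The game ends when no such vertex exists. Dominator aims to minimize the total number of selected vertices, Staller aims to maximize it. The Staller-start game total isolation number $\gamma_{\rm it}^{\rm g\prime}(G)$ is the number of moves in the game in which Staller makes the first move and both players play optimally. -}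

module Defs where

open import Data.Nat using (ℕ; zero; suc; _+_; _⊔_; _⊓_; _≤_)
open import Data.Product using (_×_; Σ)
open import Relation.Nullary using (yes; no)
open import Data.Bool.ListAction using (any)
open import Data.Fin using (Fin; _≟_)
open import Data.Bool using (Bool; true; false; _∧_; _∨_; not)
open import Data.List using (List; []; _∷_; allFin; filterᵇ; length; foldr; map)
open import Relation.Binary.PropositionalEquality using (_≡_)

record Graph (n : ℕ) : Set where
  field
    adj    : Fin n → Fin n → Bool
    sym    : ∀ u v → adj u v ≡ adj v u
    irrefl : ∀ v → adj v v ≡ false
open Graph public

data Walk {n : ℕ} (G : Graph n) : Fin n → Fin n → Set where
  here : ∀ {u} → Walk G u u
  step : ∀ {u w v} → adj G u w ≡ true → Walk G w v → Walk G u v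

Connected : ∀ {n} → Graph n → Set
Connected G = ∀ u v → Walk G u v

degree : ∀ {n} → Graph n → Fin n → ℕ
degree {n} G v = length (filterᵇ (adj G v) (allFin n))

IsMinDegree : ∀ {n} → Graph n → ℕ → Set
IsMinDegree {n} G δ = (∀ v → δ ≤ degree G v) × Σ (Fin n) (λ v → degree G v ≡ δ)

VSet : ℕ → Set
VSet n = Fin n → Bool

inN : ∀ {n} → Graph n → VSet n → Fin n → Bool
inN {n} G S v = any (λ w → S w ∧ adj G w v) (allFin n)

inRest : ∀ {n} → Graph n → VSet n → Fin n → Bool
inRest G S u = not (inN G S u)

hasNbrInRest : ∀ {n} → Graph n → VSet n → Fin n → Bool
hasNbrInRest {n} G S u = any (λ w → adj G u w ∧ inRest G S w) (allFin n)

-- u lies in a component of G - N_G(S) of order at least 2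
inBigComp : ∀ {n} → Graph n → VSet n → Fin n → Bool
inBigComp G S u = inRest G S u ∧ hasNbrInRest G S u

isolatedSelected : ∀ {n} → Graph n → VSet n → Fin n → Bool
isolatedSelected G S u = S u ∧ inRest G S u ∧ not (hasNbrInRest G S u)

legal : ∀ {n} → Graph n → VSet n → Fin n → Bool
legal {n} G S v =
  any (λ u → adj G v u ∧ (inBigComp G S u ∨ isolatedSelected G S u)) (allFin n)

legalMoves : ∀ {n} → Graph n → VSet n → List (Fin n)
legalMoves {n} G S = filterᵇ (legal G S) (allFin n)

insert : ∀ {n} → VSet n → Fin n → VSet n
insert S v w with w ≟ v
... | yes _ = true
... | no _ = S w

pick : Bool → ℕ → ℕ → ℕ
pick true  = _⊓_
pick false = _⊔_

-- Optimal-play number of remaining moves, with fuel.  `dom = true` means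
-- it is Dominator's turn (minimiser), otherwise Staller's (maximiser).
-- Every legal move selects a vertex not yet in S, so fuel n suffices.
gameValue : ∀ {n} → Graph n → ℕ → Bool → VSet n → ℕ
gameValue G zero dom S = 0
gameValue G (suc k) dom S with legalMoves G S
... | [] = 0
... | m ∷ ms = suc (foldr op (val m) (map val ms))
  where
    val : _ → ℕ
    val v = gameValue G k (not dom) (insert S v)
    op : ℕ → ℕ → ℕ
    op = pick dom

emptySet : ∀ {n} → VSet n
emptySet _ = false

gammaItStaller : ∀ {n} → Graph n → ℕ
gammaItStaller {n} G = gameValue G n false emptySet

{-# OPTIONS --safe #-}

-- Call a vertex unhandled if it is not dominated and either has an undominated
-- neighbour or is selected; a move is legal iff it has an unhandled neighbour,
-- and an unhandled neighbour of a move becomes handled.  Staller's first move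
-- handles at least δ vertices and each later one at least 1.  As long as
-- Dominator can handle two vertices per move he does so, which after m moves
-- leaves at most n − δ − 3(m−1)/2 unhandled vertices.
-- When he no longer can, the U unhandled vertices are selected, with
-- neighbourhoods that are pairwise disjoint and avoid the m selected vertices,
-- so m + δU ≤ n, while at most U moves remain.  Adding 2(δ−1) times the first
-- inequality to the second gives the bound on m + U.

module Submission where

open import Defs
open import Data.Bool using (Bool; true; false; T?; _∧_; _∨_; not)
import Data.Bool as Bool
open import Data.Bool.ListAction using (any)
open import Data.Bool.Properties using (T-≡; ∧-conicalˡ; ∧-conicalʳ; ∨-zeroʳ; ¬-not; not-¬)
open import Data.Empty using (⊥; ⊥-elim)
open import Data.Fin using (Fin; _≟_)
open import Data.Fin.Properties using (any?)
open import Data.List using (List; []; _∷_; allFin; filterᵇ; length; foldr; map)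
open import Data.List.Membership.Propositional using (_∈_)
open import Data.List.Membership.Propositional.Properties
  using (∈-allFin; ∈-filter⁺; ∈-filter⁻; ∈-map⁻; foldr-selective)
open import Data.List.Properties using (length-filter; length-tabulate; foldr-preservesᵒ)
open import Data.List.Relation.Unary.All using (_∷_)
import Data.List.Relation.Unary.All as All
open import Data.List.Relation.Unary.AllPairs using (_∷_)
open import Data.List.Relation.Unary.Any using (here; there)
import Data.List.Relation.Unary.Any as Any
open import Data.List.Relation.Unary.Any.Properties using (map⁺)
open import Data.List.Relation.Unary.Unique.Propositional using (Unique)
open import Data.List.Relation.Unary.Unique.Propositional.Properties using (allFin⁺; filter⁺)
open import Data.Nat using (ℕ; zero; suc; _+_; _*_; _∸_; _⊓_; _≤_; z≤n; s≤s)
open import Data.Nat.Properties hiding (_≟_)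
open import Data.Nat.Tactic.RingSolver using (solve-∀)
open import Data.Product using (∃; _×_; _,_; proj₁; proj₂)
open import Data.Sum using (_⊎_; inj₁; inj₂; [_,_]′)
open import Function using (_∘_; id)
open import Function.Bundles using (module Equivalence)
open import Relation.Binary.PropositionalEquality
  using (_≡_; _≢_; refl; trans; cong; cong₂; subst; subst₂) renaming (sym to ≡-sym)
open import Relation.Nullary using (yes; no; ¬_; ¬?; _×-dec_; does)
open import Relation.Nullary.Decidable using (dec-true; dec-false)

private
  variable
    A : Set
    n : ℕ

-- Boolean predicates and counting

_⊆ᵇ_ : (A → Bool) → (A → Bool) → Set
p ⊆ᵇ q = ∀ {x} → p x ≡ true → q x ≡ true

any-true⁻ : ∀ (p : A → Bool) xs → any p xs ≡ true → ∃ λ x → x ∈ xs × p x ≡ true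
any-true⁻ p (x ∷ xs) h with p x in px
... | true  = x , here refl , px
... | false with any-true⁻ p xs h
...   | y , y∈ , py = y , there y∈ , py

any-true⁺ : ∀ (p : A → Bool) {x xs} → x ∈ xs → p x ≡ true → any p xs ≡ true
any-true⁺ p (here refl) px rewrite px = refl
any-true⁺ p {xs = y ∷ _} (there x∈) px rewrite any-true⁺ p x∈ px = ∨-zeroʳ (p y)

length-filterᵇ-disjoint : ∀ (p q r : A → Bool) → p ⊆ᵇ r → q ⊆ᵇ r →
  (∀ {x} → p x ≡ true → q x ≡ true → ⊥) →
  ∀ xs → length (filterᵇ p xs) + length (filterᵇ q xs) ≤ length (filterᵇ r xs)
length-filterᵇ-disjoint p q r p⊆r q⊆r p#q [] = z≤n
length-filterᵇ-disjoint p q r p⊆r q⊆r p#q (x ∷ xs)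
  with ih ← length-filterᵇ-disjoint p q r p⊆r q⊆r p#q xs
  with p x in px | q x in qx | r x in rx
... | true  | true  | _     = ⊥-elim (p#q px qx)
... | true  | false | true  = s≤s ih
... | true  | false | false = ⊥-elim (not-¬ (p⊆r px) rx)
... | false | true  | true  = ≤-trans (≤-reflexive (+-suc _ _)) (s≤s ih)
... | false | true  | false = ⊥-elim (not-¬ (q⊆r qx) rx)
... | false | false | true  = m≤n⇒m≤1+n ih
... | false | false | false = ih

count : (Fin n → Bool) → ℕ
count p = length (filterᵇ p (allFin _))

count≤n : (p : Fin n → Bool) → count p ≤ n
count≤n p = ≤-trans (length-filter (T? ∘ p) (allFin _)) (≤-reflexive (length-tabulate id))

∈-filterᵇ⁺ : (p : Fin n → Bool) {x : Fin n} → p x ≡ true → x ∈ filterᵇ p (allFin n)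
∈-filterᵇ⁺ p px = ∈-filter⁺ (T? ∘ p) (∈-allFin _) (Equivalence.from T-≡ px)

∈-filterᵇ⁻ : (p : Fin n → Bool) {x : Fin n} → x ∈ filterᵇ p (allFin n) → p x ≡ true
∈-filterᵇ⁻ p x∈ = Equivalence.to T-≡ (proj₂ (∈-filter⁻ (T? ∘ p) {xs = allFin _} x∈))

count-disjoint : (p q r : Fin n → Bool) → p ⊆ᵇ r → q ⊆ᵇ r →
  (∀ {x} → p x ≡ true → q x ≡ true → ⊥) → count p + count q ≤ count r
count-disjoint p q r p⊆r q⊆r p#q = length-filterᵇ-disjoint p q r p⊆r q⊆r p#q (allFin _)

count-positive : (p : Fin n → Bool) {a : Fin n} → p a ≡ true → 1 ≤ count p
count-positive p pa = go (∈-filterᵇ⁺ p pa)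
  where
  go : ∀ {x xs} → x ∈ xs → 1 ≤ length {A = Fin _} xs
  go (here _)  = s≤s z≤n
  go (there _) = s≤s z≤n

count-drop : (p r : Fin n → Bool) {a : Fin n} → p ⊆ᵇ r → r a ≡ true → ¬ p a ≡ true →
  suc (count p) ≤ count r
count-drop p r p⊆r ra ¬pa = begin
  suc (count p)                           ≡⟨ +-comm 1 (count p) ⟩
  count p + 1                             ≤⟨ +-monoʳ-≤ (count p) (count-positive (λ x → r x ∧ not (p x))
                                               (cong₂ _∧_ ra (cong not (¬-not ¬pa)))) ⟩
  count p + count (λ x → r x ∧ not (p x)) ≤⟨ count-disjoint p (λ x → r x ∧ not (p x)) r p⊆r (∧-conicalˡ _ _)
                                               (λ px qx → not-¬ (∧-conicalʳ _ _ qx) (cong not px)) ⟩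
  count r                                 ∎
  where open ≤-Reasoning

-- Remove `b` from `r` first: the remainder still contains `p` and `a`, so two single drops compose.
count-drop₂ : (p r : Fin n → Bool) {a b : Fin n} → p ⊆ᵇ r → a ≢ b →
  r a ≡ true → r b ≡ true → ¬ p a ≡ true → ¬ p b ≡ true → 2 + count p ≤ count r
count-drop₂ p r {a} {b} p⊆r a≢b ra rb ¬pa ¬pb = ≤-trans
  (s≤s (count-drop p r∖b
    (λ {x} px → cong₂ _∧_ (p⊆r px) (cong not (dec-false (x ≟ b) (λ { refl → ¬pb px }))))
    (cong₂ _∧_ ra (cong not (dec-false (a ≟ b) a≢b))) ¬pa))
  (count-drop r∖b r (∧-conicalˡ _ _) rb
    (λ h → not-¬ (∧-conicalʳ (r b) _ h) (cong not (dec-true (b ≟ b) refl))))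
  where
  r∖b : Fin _ → Bool
  r∖b x = r x ∧ not (does (x ≟ b))

-- The filtered list has no repetitions, so at most one of its first two entries is `w`.
count≥2⇒∃≢ : (p : Fin n → Bool) (w : Fin n) → 2 ≤ count p → ∃ λ x → p x ≡ true × x ≢ w
count≥2⇒∃≢ p w 2≤ = go (filter⁺ (T? ∘ p) (allFin⁺ _)) 2≤ (∈-filterᵇ⁻ p)
  where
  go : ∀ {xs} → Unique xs → 2 ≤ length xs → (∀ {x} → x ∈ xs → p x ≡ true) →
    ∃ λ x → p x ≡ true × x ≢ w
  go {a ∷ b ∷ _} ((a≢b ∷ _) ∷ _) _ h with a ≟ w
  ... | yes refl = b , h (there (here refl)) , a≢b ∘ ≡-sym
  ... | no  a≢w  = a , h (here refl) , a≢w
  go {_ ∷ []} _ (s≤s ()) _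

-- Selection, unhandled vertices and legal moves

insert-self : (S : VSet n) (v : Fin n) → insert S v v ≡ true
insert-self S v with v ≟ v
... | yes _  = refl
... | no v≢v = ⊥-elim (v≢v refl)

insert⁺ : (S : VSet n) (v : Fin n) → S ⊆ᵇ insert S v
insert⁺ S v {w} Sw with w ≟ v
... | yes _ = refl
... | no _  = Sw

insert⁻ : (S : VSet n) (v : Fin n) {w : Fin n} → insert S v w ≡ true → w ≡ v ⊎ S w ≡ true
insert⁻ S v {w} h with w ≟ v
... | yes w≡v = inj₁ w≡v
... | no _    = inj₂ h

module _ {n : ℕ} (G : Graph n) where

  infix 4 _∼_
  _∼_ : Fin n → Fin n → Set
  u ∼ v = adj G u v ≡ true

  ∼-sym : ∀ {u v} → u ∼ v → v ∼ u
  ∼-sym {u} {v} = trans (sym G v u)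

  -- This repeats the disjunction tested inside `legal`, so that legality is by definition the
  -- existence of an unhandled neighbour.
  unhandled : VSet n → Fin n → Bool
  unhandled S u = inBigComp G S u ∨ isolatedSelected G S u

  inRest⁻ : ∀ {S u w} → inRest G S u ≡ true → S w ≡ true → ¬ w ∼ u
  inRest⁻ {S} {u} {w} ru Sw w∼u =
    not-¬ (cong not (any-true⁺ (λ w → S w ∧ adj G w u) (∈-allFin w) (cong₂ _∧_ Sw w∼u))) ru

  inRest⁺ : ∀ {S u} → (∀ {w} → S w ≡ true → ¬ w ∼ u) → inRest G S u ≡ true
  inRest⁺ {S} {u} h = cong not (¬-not λ d →
    let w , _ , e = any-true⁻ _ (allFin n) d in h (∧-conicalˡ _ _ e) (∧-conicalʳ (S w) _ e))

  inRest-insert : ∀ {S v u} → inRest G (insert S v) u ≡ true → inRest G S u ≡ true × ¬ v ∼ u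
  inRest-insert {S} {v} ru =
    inRest⁺ (λ Sw → inRest⁻ ru (insert⁺ S v Sw)) , inRest⁻ ru (insert-self S v)

  unhandled⇒inRest : ∀ {S u} → unhandled S u ≡ true → inRest G S u ≡ true
  unhandled⇒inRest {S} {u} h with inRest G S u
  ... | true = refl
  ... | false with S u
  ...   | true  = h
  ...   | false = h

  unhandled⁻ : ∀ {S u} → unhandled S u ≡ true →
    S u ≡ true ⊎ ∃ λ w → u ∼ w × inRest G S w ≡ true
  unhandled⁻ {S} {u} h with inRest G S u | hasNbrInRest G S u in nb | S u
  ... | _     | _     | true = inj₁ refl
  ... | _     | true  | false = inj₂
    (let w , _ , e = any-true⁻ _ (allFin n) nb in w , ∧-conicalˡ _ _ e , ∧-conicalʳ (adj G u w) _ e)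
  unhandled⁻ () | true  | false | false
  unhandled⁻ () | false | false | false

  unhandled-selected : ∀ {S u} → inRest G S u ≡ true → S u ≡ true → unhandled S u ≡ true
  unhandled-selected {S} {u} ru Su rewrite ru | Su with hasNbrInRest G S u
  -- With an undominated neighbour, `u` lies in a component of order at least 2; without one it is
  -- an isolated selected vertex.
  ... | true  = refl
  ... | false = refl

  unhandled-nbr : ∀ {S u w} → inRest G S u ≡ true → u ∼ w → inRest G S w ≡ true →
    unhandled S u ≡ true
  unhandled-nbr {S} {u} {w} ru u∼w rw
    rewrite ru
          | any-true⁺ (λ w → adj G u w ∧ inRest G S w) (∈-allFin w) (cong₂ _∧_ u∼w rw) = refl

  legal⁺ : ∀ {S v u} → v ∼ u → unhandled S u ≡ true → legal G S v ≡ true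
  legal⁺ {S} {v} v∼u hu = any-true⁺ (λ u → adj G v u ∧ unhandled S u) (∈-allFin _) (cong₂ _∧_ v∼u hu)

  legal⁻ : ∀ {S v} → legal G S v ≡ true → ∃ λ u → v ∼ u × unhandled S u ≡ true
  legal⁻ {S} {v} h =
    let u , _ , e = any-true⁻ _ (allFin n) h in u , ∧-conicalˡ _ _ e , ∧-conicalʳ (adj G v u) _ e

  -- A selected vertex dominates all its neighbours, while a legal move has an undominated one.
  legal⇒unselected : ∀ {S v} → legal G S v ≡ true → ¬ S v ≡ true
  legal⇒unselected l Sv = let u , v∼u , hu = legal⁻ l in inRest⁻ (unhandled⇒inRest hu) Sv v∼u

  count-insert : ∀ {S v} → legal G S v ≡ true → suc (count S) ≤ count (insert S v)
  count-insert {S} {v} l = count-drop S (insert S v) (insert⁺ S v) (insert-self S v) (legal⇒unselected l)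

  -- A move only shrinks the set of undominated vertices. The one danger is `v` itself, which
  -- becomes selected.
  unhandled-insert : ∀ {S v} → legal G S v ≡ true → unhandled (insert S v) ⊆ᵇ unhandled S
  unhandled-insert {S} {v} l {u} hu with inRest-insert (unhandled⇒inRest hu) | unhandled⁻ hu
  ... | ru , _ | inj₂ (w , u∼w , rw) = unhandled-nbr ru u∼w (proj₁ (inRest-insert rw))
  ... | ru , _ | inj₁ S'u with insert⁻ S v S'u
  ...   | inj₂ Su   = unhandled-selected ru Su
  -- Legality gave `v` an undominated neighbour before the move, so an undominated `v` was unhandled
  -- already.
  ...   | inj₁ refl = let w , v∼w , hw = legal⁻ l in unhandled-nbr ru v∼w (unhandled⇒inRest hw)

  handled-nbr : ∀ {S v u} → v ∼ u → ¬ unhandled (insert S v) u ≡ true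
  handled-nbr v∼u h = proj₂ (inRest-insert (unhandled⇒inRest h)) v∼u

  #unhandled : VSet n → ℕ
  #unhandled S = count (unhandled S)

  #unhandled-insert : ∀ {S v} → legal G S v ≡ true →
    suc (#unhandled (insert S v)) ≤ #unhandled S
  #unhandled-insert {S} {v} l =
    let _ , v∼u , hu = legal⁻ l
    in count-drop (unhandled (insert S v)) (unhandled S) (unhandled-insert l) hu (handled-nbr v∼u)

  -- Game values

  pick-selective : ∀ b x y → pick b x y ≡ x ⊎ pick b x y ≡ y
  pick-selective true  = ⊓-sel
  pick-selective false = ⊔-sel

  -- Minimum and maximum both return one of their arguments. For Staller's turns this reduces an
  -- upper bound to one that holds after every legal move.
  gameValue-attained : ∀ k b S → gameValue G (suc k) b S ≡ 0 ⊎
    ∃ λ v → legal G S v ≡ true × gameValue G (suc k) b S ≡ suc (gameValue G k (not b) (insert S v))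
  gameValue-attained k b S with legalMoves G S in eq
  ... | [] = inj₁ refl
  ... | m ∷ ms = inj₂ attained
    where
    val : Fin n → ℕ
    val v = gameValue G k (not b) (insert S v)

    is-legal : ∀ {v} → v ∈ m ∷ ms → legal G S v ≡ true
    is-legal v∈ = ∈-filterᵇ⁻ (legal G S) (subst (_ ∈_) (≡-sym eq) v∈)

    attained : ∃ λ v → legal G S v ≡ true × suc (foldr (pick b) (val m) (map val ms)) ≡ suc (val v)
    attained with foldr-selective (pick-selective b) (val m) (map val ms)
    ... | inj₁ e = m , is-legal (here refl) , cong suc e
    ... | inj₂ e = let v , v∈ , e' = ∈-map⁻ val e in v , is-legal (there v∈) , cong suc e'

  dominator-option : ∀ k S {v} → legal G S v ≡ true →
    gameValue G (suc k) true S ≤ suc (gameValue G k false (insert S v))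
  dominator-option k S {v} l with legalMoves G S | ∈-filterᵇ⁺ (legal G S) l
  ... | m ∷ ms | v∈ = s≤s (foldr-preservesᵒ {P = _≤ val v} below (val m) (map val ms) (bound v∈))
    where
    val : Fin n → ℕ
    val v = gameValue G k false (insert S v)

    below : ∀ x y → x ≤ val v ⊎ y ≤ val v → x ⊓ y ≤ val v
    below x y = [ m≤n⇒m⊓o≤n y , m≤n⇒o⊓m≤n x ]′

    bound : v ∈ m ∷ ms → val m ≤ val v ⊎ Any.Any (_≤ val v) (map val ms)
    bound (here refl) = inj₁ ≤-refl
    bound (there v∈)  = inj₂ (map⁺ (Any.map (λ { refl → ≤-refl }) v∈))

  -- Whoever plays, each move handles at least one vertex and makes none unhandled.
  gameValue≤#unhandled : ∀ k b S → gameValue G k b S ≤ #unhandled S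
  gameValue≤#unhandled zero    b S = z≤n
  gameValue≤#unhandled (suc k) b S with gameValue-attained k b S
  ... | inj₁ e rewrite e = z≤n
  ... | inj₂ (v , l , e) rewrite e =
    ≤-trans (s≤s (gameValue≤#unhandled k (not b) (insert S v))) (#unhandled-insert l)

  -- Disjoint neighbourhoods and Dominator's double moves

  disjoint-nbrs-count : ∀ {δ} → (∀ v → δ ≤ degree G v) → ∀ us → Unique us →
    (∀ {u v x} → u ∈ us → v ∈ us → u ∼ x → v ∼ x → u ≡ v) →
    length us * δ ≤ count (λ x → any (λ u → adj G u x) us)
  disjoint-nbrs-count δ≤deg [] _ _ = z≤n
  disjoint-nbrs-count {δ} δ≤deg (u ∷ us) (u∉ ∷ us!) dis = ≤-trans
    (+-mono-≤ (δ≤deg u) (disjoint-nbrs-count δ≤deg us us! (λ u∈ v∈ → dis (there u∈) (there v∈))))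
    (count-disjoint (adj G u) (λ x → any (λ u → adj G u x) us) (λ x → any (λ u → adj G u x) (u ∷ us))
      (λ {x} → any-true⁺ (λ v → adj G v x) {xs = u ∷ us} (here refl))
      (λ {x} h → let _ , v∈ , v∼x = any-true⁻ (λ v → adj G v x) us h in
        any-true⁺ (λ v → adj G v x) (there v∈) v∼x)
      -- A neighbour shared with a later entry would make that entry equal to `u`, against
      -- uniqueness.
      (λ {x} u∼x h → let _ , v∈ , v∼x = any-true⁻ (λ v → adj G v x) us h in
        All.lookup u∉ v∈ (dis (here refl) (there v∈) u∼x v∼x)))

  module _ (δ : ℕ) (δ≤deg : ∀ v → δ ≤ degree G v) (2≤δ : 2 ≤ δ) where

    good-move-or-endgame : ∀ S →
      (∃ λ v → legal G S v ≡ true × 2 + #unhandled (insert S v) ≤ #unhandled S)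
      ⊎ count S + #unhandled S * δ ≤ n
    good-move-or-endgame S
      with any? (λ v → any? λ a → any? λ b → ¬? (a ≟ b)
             ×-dec (adj G v a Bool.≟ true) ×-dec (adj G v b Bool.≟ true)
             ×-dec (unhandled S a Bool.≟ true) ×-dec (unhandled S b Bool.≟ true))
    -- Playing a common neighbour of two unhandled vertices dominates both.
    ... | yes (v , a , b , a≢b , v∼a , v∼b , ha , hb) =
      inj₁ (v , l , count-drop₂ (unhandled (insert S v)) (unhandled S) (unhandled-insert l)
        a≢b ha hb (handled-nbr v∼a) (handled-nbr v∼b))
      where
      l : legal G S v ≡ true
      l = legal⁺ v∼a ha
    ... | no ¬two
      with any? (λ u → any? λ w → (inRest G S u Bool.≟ true) ×-dec (inRest G S w Bool.≟ true)
             ×-dec (adj G u w Bool.≟ true))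
    -- Both ends of an undominated edge are unhandled, and since `u` has degree at least 2 it has a
    -- neighbour besides `w`.
    ...   | yes (u , w , ru , rw , u∼w) =
      inj₁ (play-outside (count≥2⇒∃≢ (adj G u) w (≤-trans 2≤δ (δ≤deg u))))
      where
      unique : ∀ {v a b} → v ∼ a → v ∼ b → unhandled S a ≡ true → unhandled S b ≡ true → a ≡ b
      unique {v} {a} {b} v∼a v∼b ha hb with a ≟ b
      ... | yes a≡b = a≡b
      ... | no a≢b  = ⊥-elim (¬two (v , a , b , a≢b , v∼a , v∼b , ha , hb))

      hu : unhandled S u ≡ true
      hu = unhandled-nbr ru u∼w rw

      hw : unhandled S w ≡ true
      hw = unhandled-nbr rw (∼-sym u∼w) ru

      u≢w : u ≢ w
      u≢w refl = not-¬ u∼w (irrefl G u)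

      -- u and w form a K₂ component, so dominating u from a vertex other than w
      -- leaves w isolated and unselected.
      play-outside : (∃ λ x → u ∼ x × x ≢ w) →
        ∃ λ v → legal G S v ≡ true × 2 + #unhandled (insert S v) ≤ #unhandled S
      play-outside (x , u∼x , x≢w) =
        x , l , count-drop₂ (unhandled (insert S x)) (unhandled S) (unhandled-insert l) u≢w hu hw
          (handled-nbr (∼-sym u∼x)) w-handled
        where
        l : legal G S x ≡ true
        l = legal⁺ (∼-sym u∼x) hu

        w-handled : ¬ unhandled (insert S x) w ≡ true
        w-handled h with unhandled⁻ h
        -- `w` is not the move `x`, and had it been selected earlier it would dominate `u`.
        ... | inj₁ S'w = [ x≢w ∘ ≡-sym , (λ Sw → inRest⁻ ru Sw (∼-sym u∼w)) ]′ (insert⁻ S x S'w)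
        ... | inj₂ (y , w∼y , r'y) with inRest-insert r'y
        -- `y` and `u` are both unhandled neighbours of `w` before the move, hence equal; but `x`
        -- dominates `u`.
        ...   | ry , ¬x∼y with unique w∼y (∼-sym u∼w) (unhandled-nbr ry (∼-sym w∼y) rw) hu
        ...     | refl = ¬x∼y (∼-sym u∼x)
    -- By `¬two`, unhandled vertices have pairwise disjoint neighbourhoods. These avoid `S` because
    -- unhandled vertices are undominated, so everything packs into the `n` vertices.
    ...   | no ¬edge = inj₂ (begin
      count S + #unhandled S * δ                         ≤⟨ +-monoʳ-≤ (count S) (disjoint-nbrs-count δ≤deg us
                                                              (filter⁺ (T? ∘ unhandled S) (allFin⁺ n)) disjoint) ⟩
      count S + count (λ x → any (λ u → adj G u x) us)   ≤⟨ count-disjoint S (λ x → any (λ u → adj G u x) us) (λ _ → true)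
                                                              (λ _ → refl) (λ _ → refl) unselected ⟩
      count {n} (λ _ → true)                             ≤⟨ count≤n _ ⟩
      n                                                  ∎)
      where
      open ≤-Reasoning

      us : List (Fin n)
      us = filterᵇ (unhandled S) (allFin n)

      disjoint : ∀ {u v x} → u ∈ us → v ∈ us → u ∼ x → v ∼ x → u ≡ v
      disjoint {u} {v} {x} u∈ v∈ u∼x v∼x with u ≟ v
      ... | yes u≡v = u≡v
      ... | no u≢v  = ⊥-elim (¬two (x , u , v , u≢v , ∼-sym u∼x , ∼-sym v∼x ,
                        ∈-filterᵇ⁻ (unhandled S) u∈ , ∈-filterᵇ⁻ (unhandled S) v∈))

      unselected : ∀ {x} → S x ≡ true → any (λ u → adj G u x) us ≡ true → ⊥
      unselected Sx h =
        let u , u∈ , u∼x = any-true⁻ (λ u → adj G u _) us h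
        in inRest⁻ (unhandled⇒inRest (∈-filterᵇ⁻ (unhandled S) u∈)) Sx (∼-sym u∼x)

  -- The weighted bound along the game

  module _ (d : ℕ) (δ≤deg : ∀ v → 2 + d ≤ degree G v) where

    -- The claimed inequality for `t` moves with δ = 2 + d, cleared of denominators and subtraction.
    Bounded : ℕ → Set
    Bounded t = (4 + 3 * d) * t + (1 + d) * (1 + 2 * d) ≤ (3 + 2 * d) * n

    Bounded-mono : ∀ {s t} → s ≤ t → Bounded t → Bounded s
    Bounded-mono s≤t = ≤-trans (+-monoˡ-≤ _ (*-monoʳ-≤ (4 + 3 * d) s≤t))

    -- The first hypothesis is already doubled, so its weight is δ - 1 = 1 + d; this gives `m` and
    -- `U` the common coefficient 4 + 3d.
    combine : ∀ m U → 2 * U + 2 * (2 + d) + 3 * m ≤ 2 * n + 3 → m + U * (2 + d) ≤ n →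
      Bounded (m + U)
    combine m U h₁ h₂ = +-cancelʳ-≤ (3 * (1 + d)) _ _ (begin
      (4 + 3 * d) * (m + U) + (1 + d) * (1 + 2 * d) + 3 * (1 + d)       ≡⟨ lhs d m U ⟩
      (1 + d) * (2 * U + 2 * (2 + d) + 3 * m) + (m + U * (2 + d))       ≤⟨ +-mono-≤ (*-monoʳ-≤ (1 + d) h₁) h₂ ⟩
      (1 + d) * (2 * n + 3) + n                                         ≡⟨ rhs d n ⟩
      (3 + 2 * d) * n + 3 * (1 + d)                                     ∎)
      where
      open ≤-Reasoning

      lhs : ∀ d m U → (4 + 3 * d) * (m + U) + (1 + d) * (1 + 2 * d) + 3 * (1 + d)
                    ≡ (1 + d) * (2 * U + 2 * (2 + d) + 3 * m) + (m + U * (2 + d))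
      lhs = solve-∀

      rhs : ∀ d n → (1 + d) * (2 * n + 3) + n ≡ (3 + 2 * d) * n + 3 * (1 + d)
      rhs = solve-∀

    -- For positions with no further moves counted: put 0 for the unhandled vertices, so that the
    -- packing inequality becomes `m ≤ n`.
    combine-over : ∀ m U → 2 * U + 2 * (2 + d) + 3 * m ≤ 2 * n + 3 → m ≤ n → Bounded (m + 0)
    combine-over m U h m≤n = combine m 0
      (≤-trans (+-monoˡ-≤ (3 * m) (+-monoˡ-≤ (2 * (2 + d)) (z≤n {2 * U}))) h)
      (subst (_≤ n) (≡-sym (+-identityʳ m)) m≤n)

    -- Here `m` is the number of moves made. A move adds 3 to `3 * m`; Dominator's double move
    -- lowers the term in unhandled vertices by at least 4 and Staller's move by at least 2. Hence
    -- the constant alternates between 3 on Dominator's turn and 2 on Staller's.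
    dominator-bound : ∀ k S m → m ≤ count S →
      2 * #unhandled S + 2 * (2 + d) + 3 * m ≤ 2 * n + 3 → Bounded (m + gameValue G k true S)
    staller-bound : ∀ k S m → m ≤ count S →
      2 * #unhandled S + 2 * (2 + d) + 3 * m ≤ 2 * n + 2 → Bounded (m + gameValue G k false S)

    dominator-bound zero S m m≤ inv = combine-over m (#unhandled S) inv (≤-trans m≤ (count≤n S))
    dominator-bound (suc k) S m m≤ inv with good-move-or-endgame (2 + d) δ≤deg (s≤s (s≤s z≤n)) S
    -- From here on the remaining moves are bounded by the unhandled vertices alone, whatever either
    -- player does.
    ... | inj₂ end = Bounded-mono (+-monoʳ-≤ m (gameValue≤#unhandled (suc k) true S))
                       (combine m (#unhandled S) inv (≤-trans (+-monoˡ-≤ _ m≤) end))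
    ... | inj₁ (v , l , U'+2≤U) = Bounded-mono
      (≤-trans (+-monoʳ-≤ m (dominator-option k S l)) (≤-reflexive (+-suc m _)))
      (staller-bound k (insert S v) (suc m) (≤-trans (s≤s m≤) (count-insert l))
        (+-cancelʳ-≤ 1 _ _ (begin
          2 * U' + 2 * (2 + d) + 3 * suc m + 1       ≡⟨ shift U' d m ⟩
          2 * (2 + U') + 2 * (2 + d) + 3 * m         ≤⟨ +-monoˡ-≤ (3 * m) (+-monoˡ-≤ (2 * (2 + d)) (*-monoʳ-≤ 2 U'+2≤U)) ⟩
          2 * #unhandled S + 2 * (2 + d) + 3 * m     ≤⟨ inv ⟩
          2 * n + 3                                  ≡⟨ +-assoc (2 * n) 2 1 ⟨
          2 * n + 2 + 1                              ∎)))
      where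
      open ≤-Reasoning

      U' : ℕ
      U' = #unhandled (insert S v)

      shift : ∀ U d m → 2 * U + 2 * (2 + d) + 3 * suc m + 1 ≡ 2 * (2 + U) + 2 * (2 + d) + 3 * m
      shift = solve-∀

    staller-bound zero S m m≤ inv =
      combine-over m (#unhandled S) (≤-trans inv (+-monoʳ-≤ (2 * n) (n≤1+n 2))) (≤-trans m≤ (count≤n S))
    staller-bound (suc k) S m m≤ inv with gameValue-attained k false S
    ... | inj₁ e rewrite e =
      combine-over m (#unhandled S) (≤-trans inv (+-monoʳ-≤ (2 * n) (n≤1+n 2))) (≤-trans m≤ (count≤n S))
    ... | inj₂ (v , l , e) rewrite e | +-suc m (gameValue G k true (insert S v)) =
      dominator-bound k (insert S v) (suc m) (≤-trans (s≤s m≤) (count-insert l)) (begin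
        2 * U' + 2 * (2 + d) + 3 * suc m             ≡⟨ shift U' d m ⟩
        2 * (1 + U') + 2 * (2 + d) + 3 * m + 1       ≤⟨ +-monoˡ-≤ 1 (+-monoˡ-≤ (3 * m) (+-monoˡ-≤ (2 * (2 + d))
                                                          (*-monoʳ-≤ 2 (#unhandled-insert l)))) ⟩
        2 * #unhandled S + 2 * (2 + d) + 3 * m + 1   ≤⟨ +-monoˡ-≤ 1 inv ⟩
        2 * n + 2 + 1                                ≡⟨ +-assoc (2 * n) 2 1 ⟩
        2 * n + 3                                    ∎)
      where
      open ≤-Reasoning

      U' : ℕ
      U' = #unhandled (insert S v)

      shift : ∀ U d m → 2 * U + 2 * (2 + d) + 3 * suc m ≡ 2 * (1 + U) + 2 * (2 + d) + 3 * m + 1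
      shift = solve-∀

    -- The neighbours of `v` are dominated after the move, so they are disjoint from the unhandled
    -- vertices.
    first-move : ∀ v → #unhandled (insert emptySet v) + (2 + d) ≤ n
    first-move v = begin
      #unhandled (insert emptySet v) + (2 + d)      ≤⟨ +-monoʳ-≤ _ (δ≤deg v) ⟩
      #unhandled (insert emptySet v) + degree G v   ≤⟨ count-disjoint (unhandled (insert emptySet v)) (adj G v) (λ _ → true)
                                                         (λ _ → refl) (λ _ → refl) (λ h v∼u → handled-nbr v∼u h) ⟩
      count {n} (λ _ → true)                        ≤⟨ count≤n _ ⟩
      n                                             ∎
      where open ≤-Reasoning

    opening : ∀ U → U + (2 + d) ≤ n → 2 * U + 2 * (2 + d) + 3 ≤ 2 * n + 3
    opening U h = +-monoˡ-≤ 3 (subst (_≤ 2 * n) (*-distribˡ-+ 2 U (2 + d)) (*-monoʳ-≤ 2 h))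

    game-bound : ∀ k → Fin n → Bounded (gameValue G k false emptySet)
    game-bound k v₀ = bound k
      where
      U : Fin n → ℕ
      U v = #unhandled (insert emptySet v)

      no-moves : Bounded 0
      -- The bound for 0 moves follows from that for 1, obtained by imagining `v₀` selected;
      -- `first-move` also yields 1 ≤ `n`.
      no-moves = Bounded-mono (z≤n {1 + 0}) (combine-over 1 (U v₀) (opening (U v₀) (first-move v₀))
        (≤-trans (s≤s z≤n) (m+n≤o⇒n≤o (U v₀) (first-move v₀))))

      bound : ∀ k → Bounded (gameValue G k false emptySet)
      bound zero = no-moves
      bound (suc k) with gameValue-attained k false emptySet
      ... | inj₁ e rewrite e = no-moves
      ... | inj₂ (v , l , e) rewrite e = dominator-bound k (insert emptySet v) 1
        (count-positive (insert emptySet v) {v} (insert-self emptySet v)) (opening (U v) (first-move v))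

theorem3p3 : ∀ (n : ℕ) (G : Graph n) (δ : ℕ) →
    3 ≤ n → Connected G → IsMinDegree G δ → 2 ≤ δ →
    (3 * δ ∸ 2) * gammaItStaller G + (δ ∸ 1) * (2 * δ ∸ 3) ≤ (2 * δ ∸ 1) * n
theorem3p3 n G (suc (suc d)) _ _ (δ≤deg , v₀ , _) (s≤s (s≤s _)) =
  -- Distributing the products over 2 + d exposes the numerals 6 and 4, so the truncated
  -- subtractions compute to the coefficients in `Bounded`.
  subst₂ (λ x y → (x ∸ 2) * gammaItStaller G + (1 + d) * (y ∸ 3) ≤ (y ∸ 1) * n)
    (≡-sym (*-distribˡ-+ 3 2 d)) (≡-sym (*-distribˡ-+ 2 2 d)) (game-bound G d δ≤deg n v₀)
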